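{- Let $T_1=(V,E_1)$ and $T_2=(V,E_2)$ be trees on the common vertex set $V=\{1,\dots,n\}$. Suppose there are orderings $\pi_1=(\tau_1,\dots,\tau_{n-1})$ of $E_1$ and $\pi_2=(\sigma_1,\dots,\sigma_{n-1})$ of $E_2$ such that $\mathcal{K}_{\pi_1}(T_1)=\mathcal{K}_{\pi_2}(T_2)$ in $\mathbb{C}[S_n]$. Then $E_1=E_2$ (so $T_1=T_2$). Moreover, whenever two distinct edges $(i,j)$ and $(j,k)$ share the endpoint $j$ and $(i,j)$ precedes $(j,k)$ in $\pi_1$, then $(i,j)$ also precedes $(j,k)$ in $\pi_2$.
   Context: $\mathbb{C}[S_n]$ is the group algebra of the symmetric group $S_n$; an edge $(i,j)$ is identified with the transposition $(i\,j)\in S_n$. For a graph $G$ with vertex set labeled by $\{1,\dots,n\}$ and an ordering $\pi=(e_1,\dots,e_m)$ of its edges, $\mathcal{K}_\pi(G)=n!\,(1-e_1)(1-e_2)\cdots(1-e_m)\in\mathbb{C}[S_n]$, the product taken in the order given by $\pi$ (here $1$ is the identity permutation). -}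

module Defs where

open import Algebra.Bundles using (CommutativeRing)
import Algebra.Definitions.RawMonoid as RawMonoidDefs
import Algebra.Properties.Ring as RingProperties
import Algebra.Solver.Ring.NaturalCoefficients.Default as Solver
open import Data.Bool.Base using (if_then_else_)
open import Data.Fin.Base as Fin using (Fin)
import Data.Fin.Properties as Fin
open import Data.Fin.Permutation as Perm using (Permutation′; _⟨$⟩ʳ_; _∘ₚ_)
open import Data.List.Base using (List; []; _∷_; _++_; _∷ʳ_; map; foldr; length; lookup; cartesianProductWith)
open import Data.List.Membership.Propositional using (_∈_)
open import Data.List.Relation.Unary.Linked using (Linked)
open import Data.List.Relation.Unary.Unique.Propositional using (Unique)
open import Data.Nat.Base as ℕ using (ℕ; _!)
import Data.Nat.Properties as ℕ
open import Data.Product.Base using (∃; ∃₂; _×_; _,_)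
open import Data.Rational.Base as ℚ using (ℚ; 0ℚ; 1ℚ; ½)
import Data.Rational.Properties as ℚ
open import Data.Rational.Solver using (module +-*-Solver)
open import Data.Sum.Base using (_⊎_)
open import Function.Bundles using (_⇔_)
open import Level using (0ℓ)
open import Relation.Binary.Construct.Closure.ReflexiveTransitive using (Star)
open import Relation.Binary.Core using (Rel)
open import Relation.Binary.Definitions using (Decidable)
open import Relation.Binary.PropositionalEquality
  using (_≡_; refl; sym; trans; cong; cong₂; subst; subst₂)
open import Relation.Nullary using (¬_; does)
open import Relation.Unary using (Pred)

------------------------------------------------------------------------
-- Real numbers: Cauchy sequences of rationals, with equality meaning that
-- the difference tends to 0.

Cauchy : (ℕ → ℚ) → Set
Cauchy x = ∀ ε → 0ℚ ℚ.< ε →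
  ∃ λ N → ∀ m n → N ℕ.≤ m → N ℕ.≤ n → ℚ.∣ x m ℚ.- x n ∣ ℚ.< ε

record ℝ : Set where
  constructor mkℝ
  field
    seq    : ℕ → ℚ
    cauchy : Cauchy seq

open ℝ public

infix 4 _≈ℝ_

record _≈ℝ_ (x y : ℝ) : Set where
  constructor mk≈
  field
    close : ∀ ε → 0ℚ ℚ.< ε →
      ∃ λ N → ∀ n → N ℕ.≤ n → ℚ.∣ seq x n ℚ.- seq y n ∣ ℚ.< ε

open _≈ℝ_ public

private
  0<½* : ∀ {ε} → 0ℚ ℚ.< ε → 0ℚ ℚ.< ½ ℚ.* ε
  0<½* {ε} 0<ε = ℚ.positive⁻¹ _ {{ℚ.pos*pos⇒pos ½ ε {{ℚ.positive 0<ε}}}}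

  halves : ∀ ε → ½ ℚ.* ε ℚ.+ ½ ℚ.* ε ≡ ε
  halves ε = trans (sym (ℚ.*-distribʳ-+ ε ½ ½)) (ℚ.*-identityˡ ε)

  ∣p-p∣< : ∀ {p q} ε → p ≡ q → 0ℚ ℚ.< ε → ℚ.∣ p ℚ.- q ∣ ℚ.< ε
  ∣p-p∣< {p} ε refl 0<ε = subst (λ z → ℚ.∣ z ∣ ℚ.< ε) (sym (ℚ.+-inverseʳ p)) 0<ε

  ∣-∣-sym : ∀ p q → ℚ.∣ p ℚ.- q ∣ ≡ ℚ.∣ q ℚ.- p ∣
  ∣-∣-sym p q = trans (cong ℚ.∣_∣ eq) (ℚ.∣-p∣≡∣p∣ (q ℚ.- p))
    where
    open +-*-Solver
    eq : p ℚ.- q ≡ ℚ.- (q ℚ.- p)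
    eq = solve 2 (λ p q → p :- q := :- (q :- p)) refl p q

  split : ∀ {p a b} ε → p ≡ a ℚ.+ b →
          ℚ.∣ a ∣ ℚ.< ½ ℚ.* ε → ℚ.∣ b ∣ ℚ.< ½ ℚ.* ε → ℚ.∣ p ∣ ℚ.< ε
  split {a = a} {b} ε refl a< b< =
    ℚ.≤-<-trans (ℚ.∣p+q∣≤∣p∣+∣q∣ a b) (subst (_ ℚ.<_) (halves ε) (ℚ.+-mono-< a< b<))

  -- Differences of products are small if the factors are bounded and
  -- their differences are small.
  module Product {ε A D : ℚ} (0<ε : 0ℚ ℚ.< ε) (0<A : 0ℚ ℚ.< A) (0<D : 0ℚ ℚ.< D) where

    instance
      pos-ε : ℚ.Positive ε
      pos-ε = ℚ.positive 0<ε
      pos-M : ℚ.Positive (A ℚ.+ D)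
      pos-M = ℚ.positive (ℚ.+-mono-< 0<A 0<D)
      nz-M : ℚ.NonZero (A ℚ.+ D)
      nz-M = ℚ.pos⇒nonZero (A ℚ.+ D)
      pos-1/M : ℚ.Positive (ℚ.1/ (A ℚ.+ D))
      pos-1/M = ℚ.1/pos⇒pos (A ℚ.+ D)

    δ : ℚ
    δ = ℚ.1/ (A ℚ.+ D) ℚ.* ε

    instance
      pos-δ : ℚ.Positive δ
      pos-δ = ℚ.pos*pos⇒pos (ℚ.1/ (A ℚ.+ D)) ε
      nonNeg-δ : ℚ.NonNegative δ
      nonNeg-δ = ℚ.pos⇒nonNeg δ

    0<δ : 0ℚ ℚ.< δ
    0<δ = ℚ.positive⁻¹ δ

    total : A ℚ.* δ ℚ.+ δ ℚ.* D ≡ ε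
    total = trans
      (solve 3 (λ A D δ → A :* δ :+ δ :* D := (A :+ D) :* δ) refl A D δ)
      (trans (sym (ℚ.*-assoc (A ℚ.+ D) (ℚ.1/ (A ℚ.+ D)) ε))
      (trans (cong (ℚ._* ε) (ℚ.*-inverseʳ (A ℚ.+ D))) (ℚ.*-identityˡ ε)))
      where open +-*-Solver

    bound : ∀ {a b c d} → ℚ.∣ a ∣ ℚ.< A → ℚ.∣ d ∣ ℚ.< D →
            ℚ.∣ a ℚ.- c ∣ ℚ.< δ → ℚ.∣ b ℚ.- d ∣ ℚ.< δ →
            ℚ.∣ a ℚ.* b ℚ.- c ℚ.* d ∣ ℚ.< ε
    bound {a} {b} {c} {d} a<A d<D ac bd = begin-strict
      ℚ.∣ a ℚ.* b ℚ.- c ℚ.* d ∣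
        ≡⟨ cong ℚ.∣_∣ (solve 4 (λ a b c d → a :* b :- c :* d :=
             a :* (b :- d) :+ (a :- c) :* d) refl a b c d) ⟩
      ℚ.∣ a ℚ.* (b ℚ.- d) ℚ.+ (a ℚ.- c) ℚ.* d ∣
        ≤⟨ ℚ.∣p+q∣≤∣p∣+∣q∣ (a ℚ.* (b ℚ.- d)) ((a ℚ.- c) ℚ.* d) ⟩
      ℚ.∣ a ℚ.* (b ℚ.- d) ∣ ℚ.+ ℚ.∣ (a ℚ.- c) ℚ.* d ∣
        ≡⟨ cong₂ ℚ._+_ (ℚ.∣p*q∣≡∣p∣*∣q∣ a (b ℚ.- d)) (ℚ.∣p*q∣≡∣p∣*∣q∣ (a ℚ.- c) d) ⟩
      ℚ.∣ a ∣ ℚ.* ℚ.∣ b ℚ.- d ∣ ℚ.+ ℚ.∣ a ℚ.- c ∣ ℚ.* ℚ.∣ d ∣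
        ≤⟨ ℚ.+-mono-≤
             (ℚ.*-monoˡ-≤-nonNeg ℚ.∣ a ∣ {{ℚ.nonNegative (ℚ.0≤∣p∣ a)}} (ℚ.<⇒≤ bd))
             (ℚ.*-monoʳ-≤-nonNeg ℚ.∣ d ∣ {{ℚ.nonNegative (ℚ.0≤∣p∣ d)}} (ℚ.<⇒≤ ac)) ⟩
      ℚ.∣ a ∣ ℚ.* δ ℚ.+ δ ℚ.* ℚ.∣ d ∣
        <⟨ ℚ.+-mono-< (ℚ.*-monoˡ-<-pos δ a<A) (ℚ.*-monoʳ-<-pos δ d<D) ⟩
      A ℚ.* δ ℚ.+ δ ℚ.* D
        ≡⟨ total ⟩
      ε ∎
      where
      open ℚ.≤-Reasoning
      open +-*-Solver

  record Bounded (x : ℕ → ℚ) : Set where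
    field
      B     : ℚ
      0<B   : 0ℚ ℚ.< B
      from  : ℕ
      below : ∀ n → from ℕ.≤ n → ℚ.∣ x n ∣ ℚ.< B

  0<1 : 0ℚ ℚ.< 1ℚ
  0<1 = ℚ.positive⁻¹ 1ℚ

  bounded : ∀ x → Cauchy x → Bounded x
  bounded x cx with cx 1ℚ 0<1
  ... | N , p = record
    { B     = 1ℚ ℚ.+ ℚ.∣ x N ∣
    ; 0<B   = ℚ.+-mono-<-≤ 0<1 (ℚ.0≤∣p∣ (x N))
    ; from  = N
    ; below = λ n N≤n → subst (λ z → ℚ.∣ z ∣ ℚ.< 1ℚ ℚ.+ ℚ.∣ x N ∣)
        (solve 2 (λ a b → (a :- b) :+ b := a) refl (x n) (x N))
        (ℚ.≤-<-trans (ℚ.∣p+q∣≤∣p∣+∣q∣ (x n ℚ.- x N) (x N))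
          (ℚ.+-monoˡ-< ℚ.∣ x N ∣ (p n N N≤n ℕ.≤-refl)))
    }
    where open +-*-Solver

  left : ∀ m n {o} → m ℕ.⊔ n ℕ.≤ o → m ℕ.≤ o
  left m n = ℕ.m⊔n≤o⇒m≤o m n

  right : ∀ m n {o} → m ℕ.⊔ n ℕ.≤ o → n ℕ.≤ o
  right m n = ℕ.m⊔n≤o⇒n≤o m n

constℝ : ℚ → ℝ
constℝ q = mkℝ (λ _ → q) λ ε 0<ε → 0 , λ _ _ _ _ → ∣p-p∣< {q} ε refl 0<ε

infixl 6 _+ℝ_
infixl 7 _*ℝ_
infix  8 -ℝ_

_+ℝ_ : ℝ → ℝ → ℝ
seq    (x +ℝ y) n = seq x n ℚ.+ seq y n
cauchy (x +ℝ y) ε 0<ε with cauchy x _ (0<½* 0<ε) | cauchy y _ (0<½* 0<ε)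
... | M , p | N , q = M ℕ.⊔ N , λ m n m≥ n≥ →
  split ε (solve 4 (λ a b c d → (a :+ b) :- (c :+ d) := (a :- c) :+ (b :- d)) refl
            (seq x m) (seq y m) (seq x n) (seq y n))
    (p m n (left M N m≥) (left M N n≥)) (q m n (right M N m≥) (right M N n≥))
  where open +-*-Solver

-ℝ_ : ℝ → ℝ
seq    (-ℝ x) n = ℚ.- seq x n
cauchy (-ℝ x) ε 0<ε with cauchy x ε 0<ε
... | N , p = N , λ m n m≥ n≥ →
  subst (λ z → ℚ.∣ z ∣ ℚ.< ε)
    (solve 2 (λ a b → b :- a := (:- a) :- (:- b)) refl (seq x m) (seq x n))
    (p n m n≥ m≥)
  where open +-*-Solver

_*ℝ_ : ℝ → ℝ → ℝ
seq    (x *ℝ y) n = seq x n ℚ.* seq y n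
cauchy (x *ℝ y) ε 0<ε =
  combine (cauchy x P.δ P.0<δ) (cauchy y P.δ P.0<δ)
  where
  module X = Bounded (bounded (seq x) (cauchy x))
  module Y = Bounded (bounded (seq y) (cauchy y))
  module P = Product 0<ε X.0<B Y.0<B
  combine : (∃ λ M → ∀ m n → M ℕ.≤ m → M ℕ.≤ n → ℚ.∣ seq x m ℚ.- seq x n ∣ ℚ.< P.δ) →
            (∃ λ N → ∀ m n → N ℕ.≤ m → N ℕ.≤ n → ℚ.∣ seq y m ℚ.- seq y n ∣ ℚ.< P.δ) →
            ∃ λ N → ∀ m n → N ℕ.≤ m → N ℕ.≤ n →
              ℚ.∣ seq x m ℚ.* seq y m ℚ.- seq x n ℚ.* seq y n ∣ ℚ.< ε
  combine (M , p) (N , q) = (X.from ℕ.⊔ Y.from) ℕ.⊔ (M ℕ.⊔ N) , λ m n m≥ n≥ →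
    let m₁ = left (X.from ℕ.⊔ Y.from) (M ℕ.⊔ N) m≥
        n₁ = left (X.from ℕ.⊔ Y.from) (M ℕ.⊔ N) n≥
        m₂ = right (X.from ℕ.⊔ Y.from) (M ℕ.⊔ N) m≥
        n₂ = right (X.from ℕ.⊔ Y.from) (M ℕ.⊔ N) n≥
    in P.bound {a = seq x m} {b = seq y m} {c = seq x n} {d = seq y n}
         (X.below m (left X.from Y.from m₁)) (Y.below n (right X.from Y.from n₁))
         (p m n (left M N m₂) (left M N n₂)) (q m n (right M N m₂) (right M N n₂))

private
  pointwise : ∀ {x y} → (∀ n → seq x n ≡ seq y n) → x ≈ℝ y
  pointwise eq = mk≈ λ ε 0<ε → 0 , λ n _ → ∣p-p∣< ε (eq n) 0<ε

  ≈-sym : ∀ {x y} → x ≈ℝ y → y ≈ℝ x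
  close (≈-sym {x} {y} x≈y) ε 0<ε with close x≈y ε 0<ε
  ... | N , p = N , λ n n≥ → subst (ℚ._< ε) (∣-∣-sym (seq x n) (seq y n)) (p n n≥)

  ≈-trans : ∀ {x y z} → x ≈ℝ y → y ≈ℝ z → x ≈ℝ z
  close (≈-trans {x} {y} {z} x≈y y≈z) ε 0<ε
    with close x≈y _ (0<½* 0<ε) | close y≈z _ (0<½* 0<ε)
  ... | M , p | N , q = M ℕ.⊔ N , λ n n≥ →
    split ε (solve 3 (λ a b c → a :- c := (a :- b) :+ (b :- c)) refl
              (seq x n) (seq y n) (seq z n))
      (p n (left M N n≥)) (q n (right M N n≥))
    where open +-*-Solver

  +ℝ-cong : ∀ {x x′ y y′} → x ≈ℝ x′ → y ≈ℝ y′ → x +ℝ y ≈ℝ x′ +ℝ y′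
  close (+ℝ-cong {x} {x′} {y} {y′} x≈ y≈) ε 0<ε
    with close x≈ _ (0<½* 0<ε) | close y≈ _ (0<½* 0<ε)
  ... | M , p | N , q = M ℕ.⊔ N , λ n n≥ →
    split ε (solve 4 (λ a b c d → (a :+ b) :- (c :+ d) := (a :- c) :+ (b :- d)) refl
              (seq x n) (seq y n) (seq x′ n) (seq y′ n))
      (p n (left M N n≥)) (q n (right M N n≥))
    where open +-*-Solver

  -ℝ-cong : ∀ {x y} → x ≈ℝ y → -ℝ x ≈ℝ -ℝ y
  close (-ℝ-cong {x} {y} x≈y) ε 0<ε with close x≈y ε 0<ε
  ... | N , p = N , λ n n≥ → subst (ℚ._< ε)
    (trans (∣-∣-sym (seq x n) (seq y n)) (cong ℚ.∣_∣
      (solve 2 (λ a b → b :- a := (:- a) :- (:- b)) refl (seq x n) (seq y n))))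
    (p n n≥)
    where open +-*-Solver

  *ℝ-cong : ∀ {x x′ y y′} → x ≈ℝ x′ → y ≈ℝ y′ → x *ℝ y ≈ℝ x′ *ℝ y′
  close (*ℝ-cong {x} {x′} {y} {y′} x≈ y≈) ε 0<ε =
    combine (close x≈ P.δ P.0<δ) (close y≈ P.δ P.0<δ)
    where
    module X = Bounded (bounded (seq x) (cauchy x))
    module Y = Bounded (bounded (seq y′) (cauchy y′))
    module P = Product 0<ε X.0<B Y.0<B
    combine : (∃ λ M → ∀ n → M ℕ.≤ n → ℚ.∣ seq x n ℚ.- seq x′ n ∣ ℚ.< P.δ) →
              (∃ λ N → ∀ n → N ℕ.≤ n → ℚ.∣ seq y n ℚ.- seq y′ n ∣ ℚ.< P.δ) →
              ∃ λ N → ∀ n → N ℕ.≤ n →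
                ℚ.∣ seq x n ℚ.* seq y n ℚ.- seq x′ n ℚ.* seq y′ n ∣ ℚ.< ε
    combine (M , p) (N , q) = (X.from ℕ.⊔ Y.from) ℕ.⊔ (M ℕ.⊔ N) , λ n n≥ →
      let n₁ = left (X.from ℕ.⊔ Y.from) (M ℕ.⊔ N) n≥
          n₂ = right (X.from ℕ.⊔ Y.from) (M ℕ.⊔ N) n≥
      in P.bound {a = seq x n} {b = seq y n} {c = seq x′ n} {d = seq y′ n}
           (X.below n (left X.from Y.from n₁)) (Y.below n (right X.from Y.from n₁))
           (p n (left M N n₂)) (q n (right M N n₂))

ℝ-commutativeRing : CommutativeRing 0ℓ 0ℓ
ℝ-commutativeRing = record
  { Carrier = ℝ
  ; _≈_ = _≈ℝ_
  ; _+_ = _+ℝ_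
  ; _*_ = _*ℝ_
  ; -_ = -ℝ_
  ; 0# = constℝ 0ℚ
  ; 1# = constℝ 1ℚ
  ; isCommutativeRing = record
    { isRing = record
      { +-isAbelianGroup = record
        { isGroup = record
          { isMonoid = record
            { isSemigroup = record
              { isMagma = record
                { isEquivalence = record
                  { refl  = pointwise (λ _ → refl)
                  ; sym   = ≈-sym
                  ; trans = ≈-trans
                  }
                ; ∙-cong = +ℝ-cong
                }
              ; assoc = λ x y z → pointwise λ n → ℚ.+-assoc (seq x n) (seq y n) (seq z n)
              }
            ; identity = (λ x → pointwise λ n → ℚ.+-identityˡ (seq x n))
                       , (λ x → pointwise λ n → ℚ.+-identityʳ (seq x n))
            }
          ; inverse = (λ x → pointwise λ n → ℚ.+-inverseˡ (seq x n))
                    , (λ x → pointwise λ n → ℚ.+-inverseʳ (seq x n))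
          ; ⁻¹-cong = -ℝ-cong
          }
        ; comm = λ x y → pointwise λ n → ℚ.+-comm (seq x n) (seq y n)
        }
      ; *-cong = *ℝ-cong
      ; *-assoc = λ x y z → pointwise λ n → ℚ.*-assoc (seq x n) (seq y n) (seq z n)
      ; *-identity = (λ x → pointwise λ n → ℚ.*-identityˡ (seq x n))
                   , (λ x → pointwise λ n → ℚ.*-identityʳ (seq x n))
      ; distrib = (λ x y z → pointwise λ n → ℚ.*-distribˡ-+ (seq x n) (seq y n) (seq z n))
                , (λ x y z → pointwise λ n → ℚ.*-distribʳ-+ (seq x n) (seq y n) (seq z n))
      }
    ; *-comm = λ x y → pointwise λ n → ℚ.*-comm (seq x n) (seq y n)
    }
  }

------------------------------------------------------------------------
-- R[i] with i² = -1; ℂ is the case R = ℝ.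

module AdjoinI {c ℓ} (R : CommutativeRing c ℓ) where

  private
    module R = CommutativeRing R
    open Solver R.commutativeSemiring

  infix  4 _≈_
  infixl 6 _+_ _+i_
  infixl 7 _*_
  infix  8 -_

  record R[i] : Set c where
    constructor _+i_
    field
      re im : R.Carrier

  open R[i] public

  record _≈_ (z w : R[i]) : Set ℓ where
    constructor _,_
    field
      re≈ : re z R.≈ re w
      im≈ : im z R.≈ im w

  open _≈_ public

  _+_ : R[i] → R[i] → R[i]
  (a +i b) + (c +i d) = (a R.+ c) +i (b R.+ d)

  -_ : R[i] → R[i]
  - (a +i b) = (R.- a) +i (R.- b)

  _*_ : R[i] → R[i] → R[i]
  (a +i b) * (c +i d) = (a R.* c R.- b R.* d) +i (a R.* d R.+ b R.* c)

  0# 1# : R[i]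
  0# = R.0# +i R.0#
  1# = R.1# +i R.0#

  private
    -- The laws are proved by a semiring solver, with -1 as an extra variable.
    n : R.Carrier
    n = R.- R.1#

    _*ₙ_ : R[i] → R[i] → R[i]
    (a +i b) *ₙ (c +i d) = (a R.* c R.+ n R.* (b R.* d)) +i (a R.* d R.+ b R.* c)

    ≈-sym′ : ∀ {z w} → z ≈ w → w ≈ z
    ≈-sym′ (p , q) = R.sym p , R.sym q

    ≈-trans′ : ∀ {z w v} → z ≈ w → w ≈ v → z ≈ v
    ≈-trans′ (p , q) (p′ , q′) = R.trans p p′ , R.trans q q′

    +-cong : ∀ {z z′ w w′} → z ≈ z′ → w ≈ w′ → z + w ≈ z′ + w′
    +-cong (p , q) (p′ , q′) = R.+-cong p p′ , R.+-cong q q′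

    *-cong : ∀ {z z′ w w′} → z ≈ z′ → w ≈ w′ → z * w ≈ z′ * w′
    *-cong (p , q) (p′ , q′) =
      R.+-cong (R.*-cong p p′) (R.-‿cong (R.*-cong q q′)) ,
      R.+-cong (R.*-cong p q′) (R.*-cong q p′)

    ≈-refl : ∀ {z} → z ≈ z
    ≈-refl = R.refl , R.refl

    to : ∀ z w → z * w ≈ z *ₙ w
    to (a +i b) (c +i d) =
      R.+-congˡ (R.sym (RingProperties.-1*x≈-x R.ring (b R.* d))) , R.refl

    *-assoc : ∀ x y z → (x * y) * z ≈ x * (y * z)
    *-assoc x@(a +i b) y@(c +i d) z@(e +i f) =
      ≈-trans′ (*-cong (to x y) ≈-refl)
      (≈-trans′ (to (x *ₙ y) z)
      (≈-trans′ assocₙ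
      (≈-trans′ (≈-sym′ (to x (y *ₙ z)))
                (*-cong (≈-refl {x}) (≈-sym′ (to y z))))))
      where
      assocₙ : (x *ₙ y) *ₙ z ≈ x *ₙ (y *ₙ z)
      assocₙ =
        solve 7 (λ a b c d e f n →
          (a :* c :+ n :* (b :* d)) :* e :+ n :* ((a :* d :+ b :* c) :* f) :=
          a :* (c :* e :+ n :* (d :* f)) :+ n :* (b :* (c :* f :+ d :* e)))
          R.refl a b c d e f n ,
        solve 7 (λ a b c d e f n →
          (a :* c :+ n :* (b :* d)) :* f :+ (a :* d :+ b :* c) :* e :=
          a :* (c :* f :+ d :* e) :+ b :* (c :* e :+ n :* (d :* f)))
          R.refl a b c d e f n

    *-comm : ∀ x y → x * y ≈ y * x
    *-comm (a +i b) (c +i d) =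
      R.+-cong (R.*-comm a c) (R.-‿cong (R.*-comm b d)) ,
      R.trans (R.+-comm (a R.* d) (b R.* c)) (R.+-cong (R.*-comm b c) (R.*-comm a d))

    *-identityˡ : ∀ x → 1# * x ≈ x
    *-identityˡ x@(a +i b) = ≈-trans′ (to 1# x)
      ( solve 3 (λ a b n → con 1 :* a :+ n :* (con 0 :* b) := a) R.refl a b n
      , solve 2 (λ a b → con 1 :* b :+ con 0 :* a := b) R.refl a b )

    *-distribˡ-+ : ∀ x y z → x * (y + z) ≈ x * y + x * z
    *-distribˡ-+ x@(a +i b) y@(c +i d) z@(e +i f) =
      ≈-trans′ (to x (y + z))
      (≈-trans′ distribₙ (≈-sym′ (+-cong (to x y) (to x z))))
      where
      distribₙ : x *ₙ (y + z) ≈ (x *ₙ y) + (x *ₙ z)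
      distribₙ =
        solve 7 (λ a b c d e f n →
          a :* (c :+ e) :+ n :* (b :* (d :+ f)) :=
          (a :* c :+ n :* (b :* d)) :+ (a :* e :+ n :* (b :* f)))
          R.refl a b c d e f n ,
        solve 6 (λ a b c d e f →
          a :* (d :+ f) :+ b :* (c :+ e) :=
          (a :* d :+ b :* c) :+ (a :* f :+ b :* e))
          R.refl a b c d e f

  commutativeRing : CommutativeRing c ℓ
  commutativeRing = record
    { Carrier = R[i]
    ; _≈_ = _≈_
    ; _+_ = _+_
    ; _*_ = _*_
    ; -_ = -_
    ; 0# = 0#
    ; 1# = 1#
    ; isCommutativeRing = record
      { isRing = record
        { +-isAbelianGroup = record
          { isGroup = record
            { isMonoid = record
              { isSemigroup = record
                { isMagma = record
                  { isEquivalence = record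
                    { refl = ≈-refl ; sym = ≈-sym′ ; trans = ≈-trans′ }
                  ; ∙-cong = +-cong
                  }
                ; assoc = λ x y z →
                    R.+-assoc (re x) (re y) (re z) , R.+-assoc (im x) (im y) (im z)
                }
              ; identity =
                  (λ x → R.+-identityˡ (re x) , R.+-identityˡ (im x)) ,
                  (λ x → R.+-identityʳ (re x) , R.+-identityʳ (im x))
              }
            ; inverse =
                (λ x → R.-‿inverseˡ (re x) , R.-‿inverseˡ (im x)) ,
                (λ x → R.-‿inverseʳ (re x) , R.-‿inverseʳ (im x))
            ; ⁻¹-cong = λ (p , q) → R.-‿cong p , R.-‿cong q
            }
          ; comm = λ x y → R.+-comm (re x) (re y) , R.+-comm (im x) (im y)
          }
        ; *-cong = *-cong
        ; *-assoc = *-assoc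
        ; *-identity =
            *-identityˡ , λ x → ≈-trans′ (*-comm x 1#) (*-identityˡ x)
        ; distrib =
            *-distribˡ-+ ,
            λ x y z → ≈-trans′ (*-comm (y + z) x)
              (≈-trans′ (*-distribˡ-+ x y z) (+-cong (*-comm x y) (*-comm x z)))
        }
      ; *-comm = *-comm
      }
    }

ℂ-commutativeRing : CommutativeRing 0ℓ 0ℓ
ℂ-commutativeRing = AdjoinI.commutativeRing ℝ-commutativeRing

------------------------------------------------------------------------

-- An edge of a graph on Fin n is an unordered pair of distinct vertices,
-- stored in increasing order so that equality of edges is propositional
-- equality.
record Edge (n : ℕ) : Set where
  constructor mkEdge
  field
    lo hi  : Fin n
    .lo<hi : lo Fin.< hi

open Edge public using (lo; hi)

Graph : ℕ → Set₁
Graph n = Pred (Edge n) 0ℓ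

module _ {n : ℕ} where

  infix 4 _∈ᵉ_

  _∈ᵉ_ : Fin n → Edge n → Set
  j ∈ᵉ e = j ≡ lo e ⊎ j ≡ hi e

  Joins : Edge n → Fin n → Fin n → Set
  Joins e i j = (lo e ≡ i × hi e ≡ j) ⊎ (lo e ≡ j × hi e ≡ i)

  Adj : Graph n → Rel (Fin n) 0ℓ
  Adj E i j = ∃ λ e → E e × Joins e i j

  Connected : Graph n → Set
  Connected E = ∀ i j → Star (Adj E) i j

  -- v ∷ vs lists the distinct vertices of a cycle, the last one being
  -- adjacent to v.
  IsCycle : Graph n → Fin n → List (Fin n) → Set
  IsCycle E v vs = 2 ℕ.≤ length vs × Unique (v ∷ vs) × Linked (Adj E) (v ∷ vs ∷ʳ v)

  Acyclic : Graph n → Set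
  Acyclic E = ∀ v vs → ¬ IsCycle E v vs

  record IsTree (E : Graph n) : Set where
    field
      nonempty  : Fin n
      connected : Connected E
      acyclic   : Acyclic E

  record Ordering (E : Graph n) : Set where
    field
      edges    : List (Edge n)
      unique   : Unique edges
      complete : ∀ e → e ∈ edges ⇔ E e

  open Ordering public using (edges)

  Precedes : {E : Graph n} → Ordering E → Edge n → Edge n → Set
  Precedes π e f = ∃₂ λ p q →
    p Fin.< q × lookup (edges π) p ≡ e × lookup (edges π) q ≡ f

  transposition : Edge n → Permutation′ n
  transposition e = Perm.transpose (lo e) (hi e)

------------------------------------------------------------------------
-- The group algebra R[Sₙ]: formal R-linear combinations of permutations,
-- two of them being equal when all their coefficients are.

_≟ₚ_ : ∀ {n} → Decidable (Perm._≈_ {n} {n})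
π ≟ₚ ρ = Fin.all? λ i → (π ⟨$⟩ʳ i) Fin.≟ (ρ ⟨$⟩ʳ i)

module GroupAlgebra {c ℓ} (R : CommutativeRing c ℓ) (n : ℕ) where

  private module R = CommutativeRing R
  open RawMonoidDefs R.+-rawMonoid using () renaming (_×_ to _×ᴿ_)

  R[S] : Set c
  R[S] = List (R.Carrier × Permutation′ n)

  -- Terms whose permutations coincide are added up.
  coeff : R[S] → Permutation′ n → R.Carrier
  coeff []            σ = R.0#
  coeff ((c , τ) ∷ a) σ = if does (τ ≟ₚ σ) then c R.+ coeff a σ else coeff a σ

  infix  4 _≈_
  infixl 6 _+_ _-_
  infixl 7 _*_
  infixr 7 _·_
  infix  8 -_

  _≈_ : Rel R[S] ℓ
  a ≈ b = ∀ σ → coeff a σ R.≈ coeff b σ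

  _+_ : R[S] → R[S] → R[S]
  _+_ = _++_

  _·_ : R.Carrier → R[S] → R[S]
  r · a = map (λ (c , σ) → r R.* c , σ) a

  -_ : R[S] → R[S]
  - a = map (λ (c , σ) → R.- c , σ) a

  _-_ : R[S] → R[S] → R[S]
  a - b = a + - b

  -- The product of permutations is (σ τ)(i) = σ (τ (i)), whereas π ∘ₚ ρ
  -- applies π first.
  _*_ : R[S] → R[S] → R[S]
  _*_ = cartesianProductWith λ (c , σ) (d , τ) → c R.* d , τ ∘ₚ σ

  ⟦_⟧ : Permutation′ n → R[S]
  ⟦ σ ⟧ = (R.1# , σ) ∷ []

  1# : R[S]
  1# = ⟦ Perm.id ⟧

  𝒦 : {E : Graph n} → Ordering E → R[S]
  𝒦 π = ((n !) ×ᴿ R.1#) · foldr (λ e a → (1# - ⟦ transposition e ⟧) * a) 1# (edges π)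

{-# OPTIONS --safe #-}

-- Expanding (1 - e₁)⋯(1 - eₘ) gives, for every sublist F of the ordering, a term
-- ± ∏F.  In a forest the product of a list F of distinct edges moves every
-- endpoint of an edge of F: a vertex travels along a trail of distinct edges,
-- which cannot close up.  Hence ∏F = (i j) forces F = [(i j)] and, when (i j) and
-- (j k) are edges of the forest, ∏F = (i j)(j k) forces F = [(i j), (j k)].  The
-- coefficient of such a permutation in 𝒦 is therefore nonzero exactly when this F
-- is a sublist of the ordering, so 𝒦 determines which of these F are sublists.

module Submission where

open import Defs
open import Algebra.Bundles using (CommutativeRing)
import Algebra.Definitions.RawMonoid as RawMonoidDefs
import Algebra.Properties.Monoid.Mult as MonoidMult
import Algebra.Properties.Ring as RingProperties
import Algebra.Properties.Semiring.Mult as SemiringMult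
open import Data.Fin.Base as Fin using (Fin)
open import Data.Fin.Permutation as Perm using (Permutation′; _⟨$⟩ʳ_; _∘ₚ_)
import Data.Fin.Properties as Fin
open import Data.List.Base as List using (List; []; _∷_; _++_; foldr; lookup)
open import Data.List.Membership.Propositional using (_∈_; _∉_; find; lose)
open import Data.List.Membership.Propositional.Properties
  using (∈-∃++; ∈-lookup; ∈-map⁺; ∈-map⁻; ∈-cartesianProductWith⁺; ∈-cartesianProductWith⁻)
open import Data.List.Relation.Binary.Sublist.Propositional
  using (_⊆_; []; _∷_; _∷ʳ_; from∈; to∈)
open import Data.List.Relation.Binary.Sublist.Propositional.Properties using (All-resp-⊆)
open import Data.List.Relation.Unary.All as All using (All; []; _∷_)
import Data.List.Relation.Unary.All.Properties as All
open import Data.List.Relation.Unary.AllPairs using ([]; _∷_)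
open import Data.List.Relation.Unary.Any as Any using (Any; here; there)
open import Data.List.Relation.Unary.Any.Properties using (lookup-index)
open import Data.List.Relation.Unary.Linked using (Linked; []; [-]; _∷_)
open import Data.List.Relation.Unary.Unique.Propositional using (Unique)
open import Data.Nat.Base as ℕ using (ℕ; zero; suc; _!; z≤n; s≤s)
import Data.Nat.Properties as ℕ
open import Data.Product.Base using (∃; ∃₂; _×_; _,_; proj₂)
open import Data.Rational.Base as ℚ using (0ℚ; 1ℚ)
import Data.Rational.Properties as ℚ
open import Data.Sum.Base using (_⊎_; inj₁; inj₂; [_,_]′)
open import Function.Base using (_∘_; case_of_; it)
open import Function.Bundles using (Equivalence)
open import Relation.Binary.PropositionalEquality
  using (_≡_; _≢_; refl; sym; trans; cong; subst; ≢-sym)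
open import Relation.Nullary using (¬_; Dec; yes; no; contradiction)
open import Relation.Nullary.Decidable using (dec-true; dec-false; recompute; _⊎-dec_)
open import Relation.Unary using (_≐_)

module _ {n : ℕ} where

  private variable
    E : Graph n
    e f g : Edge n
    F es : List (Edge n)
    i j k u v w : Fin n

  -- Edges and transpositions

  lo≢hi : (e : Edge n) → lo e ≢ hi e
  -- The order proof is irrelevant, so it is recovered by deciding `l < h` again.
  lo≢hi (mkEdge l h l<h) = Fin.<⇒≢ (recompute (l Fin.<? h) l<h)

  joins-sym : ∀ e → Joins e i j → Joins e j i
  joins-sym e (inj₁ p) = inj₂ p
  joins-sym e (inj₂ p) = inj₁ p

  joins⇒≢ : ∀ e → Joins e i j → i ≢ j
  joins⇒≢ e (inj₁ (refl , refl)) = lo≢hi e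
  joins⇒≢ e (inj₂ (refl , refl)) = ≢-sym (lo≢hi e)

  -- Endpoints are stored in increasing order, so opposite orientations would need both `l < h` and
  -- `h < l`.
  joins-unique : ∀ e f → Joins e i j → Joins f i j → e ≡ f
  joins-unique e f (inj₁ (refl , refl)) (inj₁ (refl , refl)) = refl
  joins-unique e f (inj₂ (refl , refl)) (inj₂ (refl , refl)) = refl
  joins-unique (mkEdge l h l<h) (mkEdge _ _ h<l) (inj₁ (refl , refl)) (inj₂ (refl , refl)) =
    contradiction (recompute (h Fin.<? l) h<l) (Fin.<-asym (recompute (l Fin.<? h) l<h))
  joins-unique (mkEdge l h l<h) (mkEdge _ _ h<l) (inj₂ (refl , refl)) (inj₁ (refl , refl)) =
    contradiction (recompute (h Fin.<? l) h<l) (Fin.<-asym (recompute (l Fin.<? h) l<h))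

  ∈ᵉ⇒joins : ∀ e → i ∈ᵉ e → ∃ (Joins e i)
  ∈ᵉ⇒joins e (inj₁ refl) = hi e , inj₁ (refl , refl)
  ∈ᵉ⇒joins e (inj₂ refl) = lo e , inj₂ (refl , refl)

  ∈ᵉ⇒≡⊎≡ : ∀ e → Joins e i j → v ∈ᵉ e → v ≡ i ⊎ v ≡ j
  ∈ᵉ⇒≡⊎≡ e (inj₁ (refl , refl)) v∈e = v∈e
  ∈ᵉ⇒≡⊎≡ e (inj₂ (refl , refl)) (inj₁ p) = inj₂ p
  ∈ᵉ⇒≡⊎≡ e (inj₂ (refl , refl)) (inj₂ p) = inj₁ p

  _∈ᵉ?_ : (v : Fin n) (e : Edge n) → Dec (v ∈ᵉ e)
  v ∈ᵉ? e = (v Fin.≟ lo e) ⊎-dec (v Fin.≟ hi e)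

  transposition-joins : ∀ e → Joins e i j → transposition e ⟨$⟩ʳ i ≡ j
  transposition-joins e (inj₁ (refl , refl)) rewrite dec-true (lo e Fin.≟ lo e) refl = refl
  transposition-joins e (inj₂ (refl , refl))
    rewrite dec-false (hi e Fin.≟ lo e) (≢-sym (lo≢hi e)) | dec-true (hi e Fin.≟ hi e) refl = refl

  transposition-fixes : ∀ e → ¬ v ∈ᵉ e → transposition e ⟨$⟩ʳ v ≡ v
  transposition-fixes {v} e v∉e
    rewrite dec-false (v Fin.≟ lo e) (v∉e ∘ inj₁) | dec-false (v Fin.≟ hi e) (v∉e ∘ inj₂) = refl

  -- The head acts last, as in the convention of `_*_` in the group algebra.
  product : List (Edge n) → Permutation′ n
  product []       = Perm.id
  product (e ∷ es) = product es ∘ₚ transposition e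

  -- Trails

  -- Trail es w vs: w ∷ vs are the consecutive vertices of a walk whose edges
  -- form a sublist of es.
  data Trail : List (Edge n) → Fin n → List (Fin n) → Set where
    stop : Trail [] w []
    skip : ∀ {vs} → Trail es w vs → Trail (e ∷ es) w vs
    step : ∀ {vs} → Joins e w u → Trail es u vs → Trail (e ∷ es) w (u ∷ vs)

  trail-linked : ∀ {vs} → All E es → Trail es w vs → Linked (Adj E) (w ∷ vs)
  trail-linked []           stop        = [-]
  trail-linked (_ ∷ es∈E)   (skip t)    = trail-linked es∈E t
  trail-linked (e∈E ∷ es∈E) (step e~ t) = (_ , e∈E , e~) ∷ trail-linked es∈E t

  trail-head : ∀ {vs} → Trail es w (u ∷ vs) → Any (λ e → Joins e w u) es
  trail-head (skip t)   = there (trail-head t)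
  trail-head (step p _) = here p

  linked-prefix : ∀ {R : Fin n → Fin n → Set} xs {ys} →
                  Linked R (xs ++ v ∷ ys) → Linked R (List._∷ʳ_ xs v)
  linked-prefix []           _         = [-]
  linked-prefix (_ ∷ [])     (r ∷ _)   = r ∷ [-]
  linked-prefix (_ ∷ _ ∷ xs) (r ∷ rs)  = r ∷ linked-prefix (_ ∷ xs) rs

  -- `v` moves to the front because `IsCycle` lists its base vertex first.
  unique-prefix : ∀ {v : Fin n} xs {ys} → Unique (xs ++ v ∷ ys) → Unique (v ∷ xs)
  unique-prefix []       _          = [] ∷ []
  unique-prefix (x ∷ xs) (x≢ ∷ uniq) with unique-prefix xs uniq
  ... | v≢xs ∷ uxs =
    (≢-sym (All.head (All.++⁻ʳ xs x≢)) ∷ v≢xs) ∷ All.++⁻ˡ xs x≢ ∷ uxs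

  -- Distinct edges of a forest cannot lead back to a visited vertex; by induction only a return to
  -- the start `w` has to be excluded.
  trail-unique : ∀ {vs} → Acyclic E → All E es → Unique es → Trail es w vs → Unique (w ∷ vs)
  trail-unique acyc []           []            stop     = [] ∷ []
  trail-unique acyc (_ ∷ es∈E)   (_ ∷ uniq)    (skip t) = trail-unique acyc es∈E uniq t
  trail-unique {w = w} {vs = u ∷ vs} acyc (e∈E ∷ es∈E) (e≢es ∷ uniq) (step {e = e} e~ t) =
    All.¬Any⇒All¬ (u ∷ vs) w∉ ∷ uvs
    where
    uvs : Unique (u ∷ vs)
    uvs = trail-unique acyc es∈E uniq t

    w∉ : w ∉ u ∷ vs
    w∉ (here w≡u) = joins⇒≢ e e~ w≡u
    w∉ (there w∈vs) with ∈-∃++ w∈vs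
    -- Returning at once would use a second edge with the same endpoints as `e`.
    ... | [] , _ , refl with find (trail-head t)
    ...   | e′ , e′∈es , e′~ = All.lookup e≢es e′∈es (joins-unique _ _ e~ (joins-sym e′ e′~))
    -- A later return closes a cycle through `w`, `u` and at least one further vertex `x`.
    w∉ (there w∈vs) | x ∷ xs , _ , refl =
      acyc w (u ∷ x ∷ xs)
        ( s≤s (s≤s z≤n)
        , unique-prefix (u ∷ x ∷ xs) uvs
        , (_ , e∈E , e~) ∷ linked-prefix (u ∷ x ∷ xs) (trail-linked es∈E t) )

  -- The trail starts at the image of `v` and leads back to `v`: the head of `F` acts last, so the
  -- induction extends it at the front. The last component is what later separates `v` from its
  -- image.
  product-trail : ∀ F v → ∃ λ vs → Trail F (product F ⟨$⟩ʳ v) vs ×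
                  v ∈ (product F ⟨$⟩ʳ v) ∷ vs × (Any (v ∈ᵉ_) F → v ∈ vs)
  product-trail []      v = [] , stop , here refl , λ ()
  product-trail (e ∷ F) v with product-trail F v
  ... | vs , t , v∈ , moved with (product F ⟨$⟩ʳ v) ∈ᵉ? e
  ...   | yes u∈e with ∈ᵉ⇒joins e u∈e
  ...     | w , e~ rewrite transposition-joins e e~ =
            _ ∷ vs , step (joins-sym e e~) t , there v∈ , λ _ → v∈
  product-trail (e ∷ F) v | vs , t , v∈ , moved | no u∉e
    rewrite transposition-fixes e u∉e =
    vs , skip t , v∈ , λ where
      (there v∈F) → moved v∈F
      -- The image of `v` under `product F` is off `e` while `v` is on it, so the two differ and `v`
      -- lies in the tail.
      (here v∈e)  → case v∈ of λ where
        (here v≡u)   → contradiction (subst (_∈ᵉ e) v≡u v∈e) u∉e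
        (there v∈vs) → v∈vs

  -- The trail of `product-trail` starts at the image of `v` and meets `v` later, and its vertices
  -- are distinct.
  forest-moves : Acyclic E → All E F → Unique F →
                 Any (v ∈ᵉ_) F → product F ⟨$⟩ʳ v ≢ v
  forest-moves {F = F} {v = v} acyc F∈E uniq v∈F fixed with product-trail F v
  ... | vs , t , _ , moved with trail-unique acyc F∈E uniq t
  ...   | w≢vs ∷ _ = All.lookup w≢vs (moved v∈F) fixed

  -- Factorisations of a transposition and of a 3-cycle

  -- The vertex is moved by `product F`, hence by `product G`, which fixes every vertex off the
  -- edges of `G`.
  forest-factor-∈ᵉ : ∀ G → Acyclic E → All E F → Unique F → product F Perm.≈ product G →
                     g ∈ F → v ∈ᵉ g → Any (v ∈ᵉ_) G
  forest-factor-∈ᵉ {v = v} G acyc F∈E uniq F≈G g∈F v∈g with Any.any? (v ∈ᵉ?_) G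
  ... | yes v∈G = v∈G
  ... | no  v∉G = contradiction (trans (F≈G v) (fixed G v∉G))
                    (forest-moves acyc F∈E uniq (lose g∈F v∈g))
    where
    fixed : ∀ G → ¬ Any (v ∈ᵉ_) G → product G ⟨$⟩ʳ v ≡ v
    fixed []      _ = refl
    fixed (e ∷ G) v∉ rewrite fixed G (v∉ ∘ there) = transposition-fixes e (v∉ ∘ here)

  -- Each edge of `F` has both endpoints on `e`, so it equals `e`; without repetitions only the
  -- empty list competes, and its product is the identity.
  transposition-factor : Acyclic E → All E F → Unique F →
                         product F Perm.≈ product (e ∷ []) → F ≡ e ∷ []
  transposition-factor {F = F} {e = e} acyc F∈E uniq F≈e =
    conclude F uniq (All.tabulate g≡e) F≈e
    where
    g≡e : g ∈ F → g ≡ e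
    g≡e {g} g∈F with forest-factor-∈ᵉ (e ∷ []) acyc F∈E uniq F≈e g∈F (inj₁ refl)
                 | forest-factor-∈ᵉ (e ∷ []) acyc F∈E uniq F≈e g∈F (inj₂ refl)
    ... | here (inj₁ p) | here (inj₁ q) = contradiction (trans p (sym q)) (lo≢hi g)
    ... | here (inj₁ p) | here (inj₂ q) = joins-unique _ _ (inj₁ (refl , refl)) (inj₁ (sym p , sym q))
    ... | here (inj₂ p) | here (inj₁ q) = joins-unique _ _ (inj₁ (refl , refl)) (inj₂ (sym q , sym p))
    ... | here (inj₂ p) | here (inj₂ q) = contradiction (trans p (sym q)) (lo≢hi g)

    conclude : ∀ F → Unique F → All (_≡ e) F → product F Perm.≈ product (e ∷ []) → F ≡ e ∷ []
    conclude [] _ _ eq =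
      contradiction (trans (eq (lo e)) (transposition-joins e (inj₁ (refl , refl)))) (lo≢hi e)
    conclude (_ ∷ [])    _                  (refl ∷ [])      _ = refl
    conclude (_ ∷ _ ∷ _) ((e≢e ∷ _) ∷ _)    (refl ∷ refl ∷ _) _ = contradiction refl e≢e

  -- The three edges would form a triangle.
  path-closing-edge : Acyclic E → E e → E f → Joins e i j → Joins f j k → i ≢ k →
                      E g → ¬ Joins g i k
  path-closing-edge {E} {e} {f} {i} {j} {k} {g} acyc e∈E f∈E e~ f~ i≢k g∈E g~ =
    acyc i (j ∷ k ∷ [])
      ( s≤s (s≤s z≤n)
      , (joins⇒≢ e e~ ∷ i≢k ∷ []) ∷ (joins⇒≢ f f~ ∷ []) ∷ [] ∷ []
      , (_ , e∈E , e~) ∷ (_ , f∈E , f~) ∷ (_ , g∈E , joins-sym g g~) ∷ [-] )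

  -- All endpoints in `F` are among `i`, `j`, `k`, and no edge joins `i` to `k`, so only `e` and `f`
  -- can occur. The images of `i` and `j` then rule out the empty list, `e` alone, `f` alone, and
  -- `f` before `e`.
  path-factor : Acyclic E → E e → E f → Joins e i j → Joins f j k → i ≢ k →
                All E F → Unique F → product F Perm.≈ product (e ∷ f ∷ []) → F ≡ e ∷ f ∷ []
  path-factor {E} {e} {f} {i} {j} {k} {F} acyc e∈E f∈E e~ f~ i≢k F∈E uniq F≈ef =
    conclude F uniq (All.tabulate g≡e⊎g≡f) F≈ef
    where
    endpoint : g ∈ F → v ∈ᵉ g → v ≡ i ⊎ v ≡ j ⊎ v ≡ k
    endpoint g∈F v∈g with forest-factor-∈ᵉ (e ∷ f ∷ []) acyc F∈E uniq F≈ef g∈F v∈g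
    ... | here v∈e         = [ inj₁ , inj₂ ∘ inj₁ ]′ (∈ᵉ⇒≡⊎≡ e e~ v∈e)
    ... | there (here v∈f) = inj₂ (∈ᵉ⇒≡⊎≡ f f~ v∈f)

    joined : ∀ g → E g → Joins g u v → u ≡ i ⊎ u ≡ j ⊎ u ≡ k → v ≡ i ⊎ v ≡ j ⊎ v ≡ k → g ≡ e ⊎ g ≡ f
    joined g g∈E g~ (inj₁ refl)        (inj₁ refl)        = contradiction refl (joins⇒≢ g g~)
    joined g g∈E g~ (inj₁ refl)        (inj₂ (inj₁ refl)) = inj₁ (joins-unique _ _ g~ e~)
    joined g g∈E g~ (inj₁ refl)        (inj₂ (inj₂ refl)) =
      contradiction g~ (path-closing-edge acyc e∈E f∈E e~ f~ i≢k g∈E)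
    joined g g∈E g~ (inj₂ (inj₁ refl)) (inj₁ refl)        = inj₁ (joins-unique _ _ (joins-sym g g~) e~)
    joined g g∈E g~ (inj₂ (inj₁ refl)) (inj₂ (inj₁ refl)) = contradiction refl (joins⇒≢ g g~)
    joined g g∈E g~ (inj₂ (inj₁ refl)) (inj₂ (inj₂ refl)) = inj₂ (joins-unique _ _ g~ f~)
    joined g g∈E g~ (inj₂ (inj₂ refl)) (inj₁ refl)        =
      contradiction (joins-sym g g~) (path-closing-edge acyc e∈E f∈E e~ f~ i≢k g∈E)
    joined g g∈E g~ (inj₂ (inj₂ refl)) (inj₂ (inj₁ refl)) = inj₂ (joins-unique _ _ (joins-sym g g~) f~)
    joined g g∈E g~ (inj₂ (inj₂ refl)) (inj₂ (inj₂ refl)) = contradiction refl (joins⇒≢ g g~)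

    g≡e⊎g≡f : g ∈ F → g ≡ e ⊎ g ≡ f
    g≡e⊎g≡f g∈F = joined _ (All.lookup F∈E g∈F) (inj₁ (refl , refl))
                    (endpoint g∈F (inj₁ refl)) (endpoint g∈F (inj₂ refl))

    i∉f : ¬ i ∈ᵉ f
    i∉f i∈f = [ joins⇒≢ e e~ , i≢k ]′ (∈ᵉ⇒≡⊎≡ f f~ i∈f)

    k∉e : ¬ k ∈ᵉ e
    k∉e k∈e = [ ≢-sym i≢k , ≢-sym (joins⇒≢ f f~) ]′ (∈ᵉ⇒≡⊎≡ e e~ k∈e)

    ef-i : product (e ∷ f ∷ []) ⟨$⟩ʳ i ≡ j
    ef-i = trans (cong (transposition e ⟨$⟩ʳ_) (transposition-fixes f i∉f)) (transposition-joins e e~)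

    ef-j : product (e ∷ f ∷ []) ⟨$⟩ʳ j ≡ k
    ef-j = trans (cong (transposition e ⟨$⟩ʳ_) (transposition-joins f f~)) (transposition-fixes e k∉e)

    fe-j : product (f ∷ e ∷ []) ⟨$⟩ʳ j ≡ i
    fe-j = trans (cong (transposition f ⟨$⟩ʳ_) (transposition-joins e (joins-sym e e~)))
                 (transposition-fixes f i∉f)

    conclude : ∀ F → Unique F → All (λ g → g ≡ e ⊎ g ≡ f) F →
               product F Perm.≈ product (e ∷ f ∷ []) → F ≡ e ∷ f ∷ []
    conclude [] _ _ eq = contradiction (trans (eq i) ef-i) (joins⇒≢ e e~)
    conclude (_ ∷ []) _ (inj₁ refl ∷ []) eq =
      contradiction (trans (sym (transposition-joins e (joins-sym e e~))) (trans (eq j) ef-j)) i≢k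
    conclude (_ ∷ []) _ (inj₂ refl ∷ []) eq =
      contradiction (trans (sym (transposition-fixes f i∉f)) (trans (eq i) ef-i)) (joins⇒≢ e e~)
    conclude (_ ∷ _ ∷ []) _ (inj₁ refl ∷ inj₂ refl ∷ []) _ = refl
    conclude (_ ∷ _ ∷ []) _ (inj₂ refl ∷ inj₁ refl ∷ []) eq =
      contradiction (trans (sym fe-j) (trans (eq j) ef-j)) i≢k
    conclude (_ ∷ _ ∷ _) ((p ∷ _) ∷ _) (inj₁ refl ∷ inj₁ refl ∷ _) _ = contradiction refl p
    conclude (_ ∷ _ ∷ _) ((p ∷ _) ∷ _) (inj₂ refl ∷ inj₂ refl ∷ _) _ = contradiction refl p
    -- Three entries taken from two edges force a repetition.
    conclude (_ ∷ _ ∷ _ ∷ _) ((_ ∷ p ∷ _) ∷ _) (inj₁ refl ∷ _ ∷ inj₁ refl ∷ _) _ =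
      contradiction refl p
    conclude (_ ∷ _ ∷ _ ∷ _) ((_ ∷ p ∷ _) ∷ _) (inj₂ refl ∷ _ ∷ inj₂ refl ∷ _) _ =
      contradiction refl p
    conclude (_ ∷ _ ∷ _ ∷ _) (_ ∷ (p ∷ _) ∷ _) (inj₁ refl ∷ inj₂ refl ∷ inj₂ refl ∷ _) _ =
      contradiction refl p
    conclude (_ ∷ _ ∷ _ ∷ _) (_ ∷ (p ∷ _) ∷ _) (inj₂ refl ∷ inj₁ refl ∷ inj₁ refl ∷ _) _ =
      contradiction refl p

-- Sublists

module _ {A : Set} where

  unique-⊆ : {xs ys : List A} → xs ⊆ ys → Unique ys → Unique xs
  unique-⊆ []         []          = []
  unique-⊆ (_ ∷ʳ p)   (_ ∷ uniq)  = unique-⊆ p uniq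
  unique-⊆ (refl ∷ p) (y≢ ∷ uniq) = All-resp-⊆ p y≢ ∷ unique-⊆ p uniq

  -- Sublists are what the expansion yields; positions are what `Precedes` asks for.
  pair⊆⇒indices : ∀ {x y} {xs : List A} → x ∷ y ∷ [] ⊆ xs →
                  ∃₂ λ p q → p Fin.< q × lookup xs p ≡ x × lookup xs q ≡ y
  pair⊆⇒indices (_ ∷ʳ s) with pair⊆⇒indices s
  ... | p , q , p<q , px , qy = Fin.suc p , Fin.suc q , s≤s p<q , px , qy
  pair⊆⇒indices (refl ∷ s) =
    Fin.zero , Fin.suc (Any.index y∈) , s≤s z≤n , refl , sym (lookup-index y∈)
    where
    y∈ = to∈ s

  indices⇒pair⊆ : ∀ {x y} (xs : List A) →
                  ∃₂ (λ p q → p Fin.< q × lookup xs p ≡ x × lookup xs q ≡ y) → x ∷ y ∷ [] ⊆ xs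
  indices⇒pair⊆ (_ ∷ xs) (Fin.zero  , Fin.suc q , _       , refl , refl) =
    refl ∷ from∈ (∈-lookup q)
  indices⇒pair⊆ (x ∷ xs) (Fin.suc p , Fin.suc q , s≤s p<q , px , qy) =
    x ∷ʳ indices⇒pair⊆ xs (p , q , p<q , px , qy)

-- Coefficients of 𝒦

module Expansion {c ℓ} (R : CommutativeRing c ℓ) (n : ℕ) where

  open GroupAlgebra R n
  private
    module R = CommutativeRing R
    open RawMonoidDefs R.+-rawMonoid using () renaming (_×_ to _×ᴿ_)
    open MonoidMult R.+-monoid using (×-congʳ; ×-assocˡ)
    open SemiringMult R.semiring using (×-assoc-*)
    open RingProperties R.ring using (-1*x≈-x; -‿involutive)

  coeff-∷-≈ : ∀ {d τ a σ} → τ Perm.≈ σ → coeff ((d , τ) ∷ a) σ ≡ d R.+ coeff a σ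
  coeff-∷-≈ {τ = τ} {σ = σ} τ≈σ rewrite dec-true (τ ≟ₚ σ) τ≈σ = refl

  coeff-∷-≉ : ∀ {d τ a σ} → ¬ τ Perm.≈ σ → coeff ((d , τ) ∷ a) σ ≡ coeff a σ
  coeff-∷-≉ {τ = τ} {σ = σ} τ≉σ rewrite dec-false (τ ≟ₚ σ) τ≉σ = refl

  coeff-absent : ∀ a σ → (∀ {d τ} → (d , τ) ∈ a → ¬ τ Perm.≈ σ) → coeff a σ ≡ R.0#
  coeff-absent []            σ _      = refl
  coeff-absent ((d , τ) ∷ a) σ absent =
    trans (coeff-∷-≉ {d} {τ} {a} (absent (here refl))) (coeff-absent a σ (absent ∘ there))

  -- Terms with a common coefficient `r` just accumulate: `m` counts those at `σ`, so nonvanishing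
  -- reduces to that of multiples of `r`.
  coeff-multiple : ∀ a σ {r} → (∀ {d τ} → (d , τ) ∈ a → τ Perm.≈ σ → d R.≈ r) →
                   ∃ λ m → coeff a σ R.≈ m ×ᴿ r ×
                           (Any (λ x → proj₂ x Perm.≈ σ) a → ℕ.NonZero m)
  coeff-multiple []            σ _ = 0 , R.refl , λ ()
  coeff-multiple ((d , τ) ∷ a) σ same with coeff-multiple a σ (same ∘ there) | τ ≟ₚ σ
  ... | m , eq , _  | yes τ≈σ =
    suc m ,
    R.trans (R.reflexive (coeff-∷-≈ {d} {τ} {a} τ≈σ)) (R.+-cong (same (here refl) τ≈σ) eq) ,
    _
  ... | m , eq , m≢0 | no τ≉σ =
    m , R.trans (R.reflexive (coeff-∷-≉ {d} {τ} {a} τ≉σ)) eq , λ where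
      (here τ≈σ)  → contradiction τ≈σ τ≉σ
      (there x∈a) → m≢0 x∈a

  -- Expansion of the product over sublists

  expand : List (Edge n) → R[S]
  expand = foldr (λ e a → (1# - ⟦ transposition e ⟧) * a) 1#

  sign : List (Edge n) → R.Carrier
  sign []      = R.1#
  sign (e ∷ F) = (R.- R.1#) R.* sign F

  -- Makes the sign invertible, so that `multiple≉0` can cancel it.
  sign-square : ∀ F → sign F R.* sign F R.≈ R.1#
  sign-square []      = R.*-identityˡ R.1#
  sign-square (e ∷ F) = begin
    (n₁ R.* s) R.* (n₁ R.* s) ≈⟨ R.*-congˡ (R.*-comm n₁ s) ⟩
    (n₁ R.* s) R.* (s R.* n₁) ≈⟨ R.*-assoc n₁ s (s R.* n₁) ⟩
    n₁ R.* (s R.* (s R.* n₁)) ≈⟨ R.*-congˡ (R.*-assoc s s n₁) ⟨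
    n₁ R.* (s R.* s R.* n₁)   ≈⟨ R.*-congˡ (R.*-congʳ (sign-square F)) ⟩
    n₁ R.* (R.1# R.* n₁)      ≈⟨ R.*-congˡ (R.*-identityˡ n₁) ⟩
    n₁ R.* n₁                 ≈⟨ -1*x≈-x n₁ ⟩
    R.- n₁                    ≈⟨ -‿involutive R.1# ⟩
    R.1#                      ∎
    where
    open import Relation.Binary.Reasoning.Setoid R.setoid
    n₁ = R.- R.1#
    s  = sign F

  -- The anonymous function in the definition of _*_, which unification needs by name.
  private
    _⊗_ : R.Carrier × Permutation′ n → R.Carrier × Permutation′ n → R.Carrier × Permutation′ n
    (c , σ) ⊗ (d , τ) = c R.* d , τ ∘ₚ σ

  -- A term picks from each factor either the identity or minus the transposition; the edges picked
  -- the second way form `F`.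
  term⇒sublist : ∀ es {d τ} → (d , τ) ∈ expand es →
                 ∃ λ F → F ⊆ es × τ Perm.≈ product F × d R.≈ sign F
  term⇒sublist []       (here refl) = [] , [] , (λ _ → refl) , R.refl
  term⇒sublist (e ∷ es) x∈
    with ∈-cartesianProductWith⁻ _⊗_ (1# - ⟦ transposition e ⟧) (expand es) x∈
  ... | _ , _ , p∈ , y∈ , eq with term⇒sublist es y∈
  ...   | F , F⊆es , τ≈ , d≈ with p∈ | eq
  ...     | here refl         | refl =
            F , e ∷ʳ F⊆es , τ≈ , R.trans (R.*-identityˡ _) d≈
  ...     | there (here refl) | refl =
            e ∷ F , refl ∷ F⊆es , (λ v → cong (transposition e ⟨$⟩ʳ_) (τ≈ v)) , R.*-congˡ d≈

  sublist⇒term : ∀ {F es} → F ⊆ es → ∃₂ λ d τ → (d , τ) ∈ expand es × τ Perm.≈ product F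
  sublist⇒term [] = _ , _ , here refl , λ _ → refl
  sublist⇒term {es = _ ∷ es} (e ∷ʳ F⊆es) with sublist⇒term F⊆es
  ... | _ , _ , x∈ , τ≈ =
    _ , _ , ∈-cartesianProductWith⁺ _⊗_ {xs = 1# - ⟦ transposition e ⟧} (here refl) x∈ , τ≈
  sublist⇒term {es = e ∷ es} (refl ∷ F⊆es) with sublist⇒term F⊆es
  ... | _ , _ , x∈ , τ≈ =
    _ , _ , ∈-cartesianProductWith⁺ _⊗_ {xs = 1# - ⟦ transposition e ⟧} (there (here refl)) x∈ ,
    λ v → cong (transposition e ⟨$⟩ʳ_) (τ≈ v)

  -- Comparison of two orderings with equal `𝒦`

  module _ (char0 : ∀ m → .{{ℕ.NonZero m}} → ¬ m ×ᴿ R.1# R.≈ R.0#)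
           {E₁ E₂ : Graph n} (π₁ : Ordering E₁) (π₂ : Ordering E₂) (𝒦≈ : 𝒦 π₁ ≈ 𝒦 π₂) where

    private
      N : R.Carrier
      N = (n !) ×ᴿ R.1#

    -- Multiplying by `sign F` once more would make `m * n!` copies of 1 sum to 0.
    multiple≉0 : ∀ m F → .{{ℕ.NonZero m}} → ¬ m ×ᴿ (N R.* sign F) R.≈ R.0#
    multiple≉0 m F eq = char0 (m ℕ.* n !) {{ℕ.m*n≢0 m (n !) {{it}} {{n ℕ.!≢0}}}} (begin
      (m ℕ.* n !) ×ᴿ R.1#                    ≈⟨ ×-assocˡ R.1# m (n !) ⟨
      m ×ᴿ N                                 ≈⟨ ×-congʳ m (R.*-identityʳ N) ⟨
      m ×ᴿ (N R.* R.1#)                      ≈⟨ ×-congʳ m (R.*-congˡ (sign-square F)) ⟨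
      m ×ᴿ (N R.* (sign F R.* sign F))       ≈⟨ ×-congʳ m (R.*-assoc N (sign F) (sign F)) ⟨
      m ×ᴿ (N R.* sign F R.* sign F)         ≈⟨ ×-assoc-* m (N R.* sign F) (sign F) ⟨
      m ×ᴿ (N R.* sign F) R.* sign F         ≈⟨ R.*-congʳ eq ⟩
      R.0# R.* sign F                        ≈⟨ R.zeroˡ (sign F) ⟩
      R.0#                                   ∎)
      where open import Relation.Binary.Reasoning.Setoid R.setoid

    -- By `only`, every term of `𝒦 π₁` at `product F` comes from `F` itself, so these terms share
    -- one coefficient and their sum is nonzero. Without a matching sublist of `π₂` the coefficient
    -- in `𝒦 π₂` would be 0.
    factorisation-transfers : ∀ F → F ⊆ edges π₁ →
      (∀ {G} → G ⊆ edges π₁ → product G Perm.≈ product F → G ≡ F) →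
      ∃ λ G → G ⊆ edges π₂ × product G Perm.≈ product F
    factorisation-transfers F F⊆π₁ only
      with Any.any? (λ x → proj₂ x ≟ₚ product F) (expand (edges π₂))
    ... | yes found with find found
    ...   | (_ , τ) , x∈ , τ≈F with term⇒sublist (edges π₂) x∈
    ...     | G , G⊆π₂ , τ≈G , _ = G , G⊆π₂ , λ v → trans (sym (τ≈G v)) (τ≈F v)
    factorisation-transfers F F⊆π₁ only | no none = case nonzero of λ
      { (m , eq , m≢0) → contradiction
          (R.trans (R.sym eq) (R.trans (𝒦≈ (product F))
            (R.reflexive (coeff-absent (𝒦 π₂) (product F) absent))))
          (multiple≉0 m F {{m≢0}}) }
      where
      absent : ∀ {d τ} → (d , τ) ∈ 𝒦 π₂ → ¬ τ Perm.≈ product F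
      absent x∈ τ≈F with ∈-map⁻ _ x∈
      ... | _ , y∈ , refl = none (lose y∈ τ≈F)

      same : ∀ {d τ} → (d , τ) ∈ 𝒦 π₁ → τ Perm.≈ product F → d R.≈ N R.* sign F
      same x∈ τ≈F with ∈-map⁻ _ x∈
      ... | _ , y∈ , refl with term⇒sublist (edges π₁) y∈
      ...   | G , G⊆π₁ , τ≈G , d≈ with only G⊆π₁ (λ v → trans (sym (τ≈G v)) (τ≈F v))
      ...     | refl = R.*-congˡ d≈

      present : Any (λ x → proj₂ x Perm.≈ product F) (𝒦 π₁)
      present with sublist⇒term F⊆π₁
      ... | _ , _ , x∈ , τ≈F = lose (∈-map⁺ _ x∈) τ≈F

      nonzero : ∃ λ m → coeff (𝒦 π₁) (product F) R.≈ m ×ᴿ (N R.* sign F) × ℕ.NonZero m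
      nonzero with coeff-multiple (𝒦 π₁) (product F) same
      ... | m , eq , m≢0 = m , eq , m≢0 present

    module _ (acyc₁ : Acyclic E₁) (acyc₂ : Acyclic E₂) where

      private
        all-edges : ∀ {E : Graph n} (π : Ordering E) {F} → F ⊆ edges π → All E F
        all-edges π F⊆π = All-resp-⊆ F⊆π
          (All.tabulate λ {e} → Equivalence.to (Ordering.complete π e))

        unique-sublist : ∀ {E : Graph n} (π : Ordering E) {F} → F ⊆ edges π → Unique F
        unique-sublist π F⊆π = unique-⊆ F⊆π (Ordering.unique π)

      -- The factorisation of a transposition by its own edge passes to `π₂`; uniqueness in the
      -- second forest identifies the sublist found there with that edge.
      edges⊆ : ∀ {e} → E₁ e → E₂ e
      edges⊆ {e} e∈E₁ =
        let G , G⊆ , G≈e = factorisation-transfers (e ∷ [])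
              (from∈ (Equivalence.from (Ordering.complete π₁ e) e∈E₁))
              (factor π₁ acyc₁)
        in All.head (subst (All E₂) (factor π₂ acyc₂ G⊆ G≈e) (all-edges π₂ G⊆))
        where
        factor : ∀ {E : Graph n} (π : Ordering E) → Acyclic E → ∀ {G} → G ⊆ edges π →
                 product G Perm.≈ product (e ∷ []) → G ≡ e ∷ []
        factor π acyc G⊆ =
          transposition-factor acyc (all-edges π G⊆) (unique-sublist π G⊆)

      order-preserved : ∀ e f j → e ≢ f → j ∈ᵉ e → j ∈ᵉ f → Precedes π₁ e f → Precedes π₂ e f
      order-preserved e f j e≢f j∈e j∈f e<f = pair⊆⇒indices
        (let G , G⊆ , G≈ef = factorisation-transfers (e ∷ f ∷ []) ef⊆ (factor π₁ acyc₁ e∈E₁ f∈E₁)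
         -- Both edges must be known to lie in `E₂` before `path-factor` applies to the second
         -- forest.
         in subst (_⊆ edges π₂) (factor π₂ acyc₂ (edges⊆ e∈E₁) (edges⊆ f∈E₁) G⊆ G≈ef) G⊆)
        where
        ef⊆ : e ∷ f ∷ [] ⊆ edges π₁
        ef⊆ = indices⇒pair⊆ (edges π₁) e<f

        e∈E₁ : E₁ e
        e∈E₁ = All.head (all-edges π₁ ef⊆)

        f∈E₁ : E₁ f
        f∈E₁ = All.head (All.tail (all-edges π₁ ef⊆))

        factor : ∀ {E : Graph n} (π : Ordering E) → Acyclic E → E e → E f → ∀ {G} → G ⊆ edges π →
                 product G Perm.≈ product (e ∷ f ∷ []) → G ≡ e ∷ f ∷ []
        factor π acyc e∈E f∈E G⊆ =
          let i , e~ = ∈ᵉ⇒joins e j∈e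
              k , f~ = ∈ᵉ⇒joins f j∈f
              -- If the outer endpoints agreed, `e` and `f` would join the same two vertices.
              i≢k i≡k = e≢f (joins-unique e f e~ (subst (Joins f j) (sym i≡k) f~))
          in path-factor acyc e∈E f∈E (joins-sym e e~) f~ i≢k
               (all-edges π G⊆) (unique-sublist π G⊆)

-- Characteristic zero

module _ where

  private
    module Complex = CommutativeRing ℂ-commutativeRing
    open AdjoinI ℝ-commutativeRing using (re; re≈)
    open RawMonoidDefs Complex.+-rawMonoid using () renaming (_×_ to _×ℂ_)

  0≤seq-re-×1 : ∀ m i → 0ℚ ℚ.≤ seq (re (m ×ℂ Complex.1#)) i
  0≤seq-re-×1 zero    i = ℚ.≤-refl
  0≤seq-re-×1 (suc m) i = ℚ.+-mono-≤ (ℚ.nonNegative⁻¹ 1ℚ) (0≤seq-re-×1 m i)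

  1≤1+x : ∀ {x} → 0ℚ ℚ.≤ x → 1ℚ ℚ.≤ 1ℚ ℚ.+ x
  1≤1+x {x} 0≤x = subst (ℚ._≤ 1ℚ ℚ.+ x) (ℚ.+-identityʳ 1ℚ) (ℚ.+-monoʳ-≤ 1ℚ 0≤x)

  1≤x⇒∣x-0∣≮1 : ∀ {x} → 1ℚ ℚ.≤ x → ¬ ℚ.∣ x ℚ.- 0ℚ ∣ ℚ.< 1ℚ
  1≤x⇒∣x-0∣≮1 {x} 1≤x small = ℚ.<-irrefl refl (begin-strict
    1ℚ             ≤⟨ 1≤x ⟩
    x              ≡⟨ ℚ.0≤p⇒∣p∣≡p (ℚ.≤-trans (ℚ.nonNegative⁻¹ 1ℚ) 1≤x) ⟨
    ℚ.∣ x ∣        ≡⟨ cong ℚ.∣_∣ (ℚ.+-identityʳ x) ⟨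
    ℚ.∣ x ℚ.- 0ℚ ∣ <⟨ small ⟩
    1ℚ             ∎)
    where open ℚ.≤-Reasoning

  -- Every term of the rational sequence for the real part is at least 1, whereas equality with 0
  -- would bring some term strictly within 1 of 0.
  ℂ-char0 : ∀ m → .{{ℕ.NonZero m}} → ¬ m ×ℂ Complex.1# Complex.≈ Complex.0#
  ℂ-char0 (suc m) eq with close (re≈ eq) 1ℚ (ℚ.positive⁻¹ 1ℚ)
  ... | N , small = 1≤x⇒∣x-0∣≮1 (1≤1+x (0≤seq-re-×1 m N)) (small N ℕ.≤-refl)

mainTheorem7 : ∀ (n : ℕ) (E₁ E₂ : Graph n) → IsTree E₁ → IsTree E₂ →
    (π₁ : Ordering E₁) (π₂ : Ordering E₂) →
    (let open GroupAlgebra ℂ-commutativeRing n in 𝒦 π₁ ≈ 𝒦 π₂) →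
    E₁ ≐ E₂ ×
    (∀ e f j → e ≢ f → j ∈ᵉ e → j ∈ᵉ f → Precedes π₁ e f → Precedes π₂ e f)
mainTheorem7 n E₁ E₂ tree₁ tree₂ π₁ π₂ 𝒦≈ =
  ( edges⊆ ℂ-char0 π₁ π₂ 𝒦≈ acyc₁ acyc₂
  , edges⊆ ℂ-char0 π₂ π₁ (λ σ → CommutativeRing.sym ℂ-commutativeRing (𝒦≈ σ)) acyc₂ acyc₁ ) ,
  order-preserved ℂ-char0 π₁ π₂ 𝒦≈ acyc₁ acyc₂
  where
  open Expansion ℂ-commutativeRing n
  acyc₁ = IsTree.acyclic tree₁
  acyc₂ = IsTree.acyclic tree₂
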